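{- If $\Sigma$ is a finite inductive signature, then $\mathcal{J}(\Sigma)=\mathcal{J}^*(\Sigma)$.
   Context: Fix an infinite set $V$ of variables with decidable equality, and a fresh variable provider: functions $\varphi,\mathsf{fr}$ assigning to each finite $X\subseteq V$ an inhabited subset $\varphi(X)\subseteq V\setminus X$ and an element $\mathsf{fr}(X)\in\varphi(X)$. Fix disjoint sets $F$ (function symbols) and $T$ (type symbols) with decidable equality. Preelements are terms built from variables and symbols of $F$; a pretype is $S(t_1,\ldots,t_n)$ with $S\in T$ and $t_i$ preelements. $\mathrm{V}(E)$ is the set of variables of an expression $E$, $\equiv$ is syntactic identity, and $E[\bar a/\bar x]$ is simultaneous substitution. A precontext is a sequence $\Gamma=x_1:A_1,\ldots,x_n:A_n$ of pretypes with $x_k\in\varphi(\{x_1,\ldots,x_{k-1}\})$ and $\mathrm{V}(A_k)\subseteq\{x_1,\ldots,x_{k-1}\}$; $\mathrm{OV}(\Gamma)=x_1,\ldots,x_n$, $\mathrm{V}(\Gamma)=\{x_1,\ldots,x_n\}$, $\mathrm{Fresh}(\Gamma)=\varphi(\mathrm{V}(\Gamma))$, $\mathrm{fresh}(\Gamma)=\mathsf{fr}(\mathrm{V}(\Gamma))$, $E[\bar a/\Gamma]=E[\bar a/x_1,\ldots,x_n]$. Top variables: $\mathrm{TV}(\langle\rangle)=\emptyset$, $\mathrm{TV}(\Gamma,x:A)=(\mathrm{TV}(\Gamma)\setminus\mathrm{V}(A))\cup\{x\}$. A determining sequence for $\Gamma$ is a strictly increasing $\bar i=i_1,\ldots,i_k$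 in $\{1,\ldots,n\}$ with $\mathrm{TV}(\Gamma)\subseteq\{x_{i_1},\ldots,x_{i_k}\}$; for $\bar a=a_1,\ldots,a_n$ put $\bar a_{\bar i}=a_{i_1},\ldots,a_{i_k}$. A type predeclaration is $(\Gamma,S,\bar i)$ with $S\in T$, $\bar i$ determining; a function predeclaration is $(\Gamma,f,\bar i,U)$ with $f\in F$, $\bar i$ determining, $U$ a pretype with $\mathrm{V}(U)\subseteq\mathrm{V}(\Gamma)$. A presignature is a set $\Sigma$ of predeclarations with no symbol declared twice. Judgements are "$\Gamma$ context", "$A$ type $(\Gamma)$", "$a:A\ (\Gamma)$". $\mathcal{J}(\Sigma)$ is the smallest set of judgements closed under: (R1) $\langle\rangle$ context; (R2) from $\Gamma$ context and $A$ type $(\Gamma)$ infer $\Gamma,x:A$ context, for $x\in\mathrm{Fresh}(\Gamma)$; (R3) from $x_1:A_1,\ldots,x_n:A_n$ context infer $x_i:A_i\ (x_1:A_1,\ldots,x_n:A_n)$; (R4) if $(\Gamma,S,\bar i)\in\Sigma$ and $\bar a:\Delta\to\Gamma$, infer $S(\bar a_{\bar i})$ type $(\Delta)$; (R5) if $(\Gamma,f,\bar i,U)\in\Sigma$, $\bar a:\Delta\to\Gamma$ and $U[\bar a/\Gamma]$ type $(\Delta)$, infer $f(\bar a_{\bar i}):U[\bar a/\Gamma]\ (\Delta)$. Here, for $\Gamma=x_1:A_1,\ldots,x_n:A_n$, the context map "$\bar a:\Delta\to\Gamma$" abbreviates the $n+2$ judgements $\Delta$ context, $\Gamma$ context, and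 $a_k:A_k[a_1,\ldots,a_{k-1}/x_1,\ldots,x_{k-1}]\ (\Delta)$ for $k=1,\ldots,n$. $\Sigma$ is a signature if ($\Gamma$ context)$\in\mathcal{J}(\Sigma)$ whenever $(\Gamma,S,\bar i)\in\Sigma$, and ($U$ type $(\Gamma)$)$\in\mathcal{J}(\Sigma)$ whenever $(\Gamma,f,\bar i,U)\in\Sigma$. $\mathcal{J}^*(\Sigma)$ is defined exactly like $\mathcal{J}(\Sigma)$ except that (R5) is replaced by (R5*): if $(\Gamma,f,\bar i,U)\in\Sigma$ and $\bar a:\Delta\to\Gamma$ (with the context-map judgements now read in $\mathcal{J}^*(\Sigma)$), infer $f(\bar a_{\bar i}):U[\bar a/\Gamma]\ (\Delta)$ (no premiss that $U[\bar a/\Gamma]$ is a type). A signature is inductive if it is obtained from the empty signature by finitely many steps, each adding either a type predeclaration $(\Gamma,S,\bar i)$ with $S$ not yet declared and ($\Gamma$ context)$\in\mathcal{J}$ of the current signature, or a function predeclaration $(\Gamma,f,\bar i,U)$ with $f$ not yet declared and ($U$ type $(\Gamma)$)$\in\mathcal{J}$ of the current signature. -}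

module Defs where

open import Data.Bool.Base using (if_then_else_)
open import Data.Fin.Base using (Fin; opposite; _<_)
open import Data.List.Base using (List; []; _∷_; _++_; [_]; map; filter; length)
open import Data.List.Membership.Propositional using (_∈_; _∉_)
import Data.List.Membership.DecPropositional as DecMembership
open import Data.List.Relation.Binary.BagAndSetEquality using (_∼[_]_; set)
open import Data.List.Relation.Binary.Subset.Propositional using () renaming (_⊆_ to _⊆ₗ_)
open import Data.List.Relation.Unary.Linked using (Linked)
open import Data.Nat.Base using (ℕ)
open import Data.Product.Base using (_×_; _,_; proj₁; ∃-syntax)
open import Data.Sum.Base using (_⊎_; inj₁; inj₂)
open import Data.Vec.Base as Vec using (Vec)
open import Function.Bundles using (_↣_)
open import Level using (0ℓ)
open import Relation.Binary.Definitions using (DecidableEquality)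
open import Relation.Binary.PropositionalEquality.Core using (_≡_)
open import Relation.Nullary.Decidable.Core using (does; ¬?)
open import Relation.Nullary.Negation.Core using (¬_)
open import Relation.Unary using (Pred; ∅; ｛_｝; _∪_; _⊆_; _≐_)

-- Finite subsets of V are lists up to having the same members; φ and fr are
-- functions of the finite set, hence the two congruence fields.  F and T are
-- separate types, so their disjointness is built in.
record Language : Set₁ where
  infix 4 _≟V_ _≟F_ _≟T_
  field
    V          : Set
    _≟V_       : DecidableEquality V
    V-infinite : ℕ ↣ V

    φ          : List V → Pred V 0ℓ
    φ-cong     : ∀ {X Y} → X ∼[ set ] Y → φ X ⊆ φ Y
    φ-fresh    : ∀ {X x} → φ X x → x ∉ X
    fr         : List V → V
    fr-cong    : ∀ {X Y} → X ∼[ set ] Y → fr X ≡ fr Y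
    fr∈φ       : ∀ X → φ X (fr X)

    F          : Set
    _≟F_       : DecidableEquality F
    T          : Set
    _≟T_       : DecidableEquality T

module Theory (L : Language) where
  open Language L
  open DecMembership _≟V_ using (_∈?_)

  infixl 5 _▸_∶_
  infix  6 _⟨_⟩
  infix  7 _[_/_]ₑ _[_/_]ₑₛ _[_/_] _[_/_]ᵢ
  infix  4 _context _type⦅_⦆ _∶_⦅_⦆

  -- Symbols carry no arity: any symbol may be applied to any finite list.
  data Preelement : Set where
    var   : V → Preelement
    _⟨_⟩ᶠ : F → List Preelement → Preelement

  data Pretype : Set where
    _⟨_⟩ : T → List Preelement → Pretype

  mutual
    varsₑ : Preelement → List V
    varsₑ (var x)     = [ x ]
    varsₑ (f ⟨ ts ⟩ᶠ) = varsₑₛ ts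

    varsₑₛ : List Preelement → List V
    varsₑₛ []       = []
    varsₑₛ (t ∷ ts) = varsₑ t ++ varsₑₛ ts

  vars : Pretype → List V
  vars (S ⟨ ts ⟩) = varsₑₛ ts

  -- Simultaneous substitution is only ever used for the pairwise distinct
  -- variables of a context, so the order of the search is immaterial.
  _[_/_]ᵢ : ∀ {n} → V → Vec Preelement n → Vec V n → Preelement
  y [ Vec.[]     / Vec.[]     ]ᵢ = var y
  y [ a Vec.∷ as / x Vec.∷ xs ]ᵢ = if does (y ≟V x) then a else y [ as / xs ]ᵢ

  mutual
    _[_/_]ₑ : ∀ {n} → Preelement → Vec Preelement n → Vec V n → Preelement
    (var y)     [ as / xs ]ₑ = y [ as / xs ]ᵢ
    (f ⟨ ts ⟩ᶠ) [ as / xs ]ₑ = f ⟨ ts [ as / xs ]ₑₛ ⟩ᶠ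

    _[_/_]ₑₛ : ∀ {n} → List Preelement → Vec Preelement n → Vec V n → List Preelement
    []       [ as / xs ]ₑₛ = []
    (t ∷ ts) [ as / xs ]ₑₛ = t [ as / xs ]ₑ ∷ ts [ as / xs ]ₑₛ

  _[_/_] : ∀ {n} → Pretype → Vec Preelement n → Vec V n → Pretype
  (S ⟨ ts ⟩) [ as / xs ] = S ⟨ ts [ as / xs ]ₑₛ ⟩

  -- A sequence x₁ : A₁ , … , xₙ : Aₙ is stored last entry first, and so are
  -- the sequences x₁ , … , xₙ and a₁ , … , aₙ indexed like it.
  RawContext : Set
  RawContext = List (V × Pretype)

  pattern ⟨⟩ = []
  pattern _▸_∶_ Γ x A = (x , A) ∷ Γ

  OV : (Γ : RawContext) → Vec V (length Γ)
  OV ⟨⟩          = Vec.[]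
  OV (Γ ▸ x ∶ A) = x Vec.∷ OV Γ

  varsᶜ : RawContext → List V
  varsᶜ = map proj₁

  Fresh : RawContext → Pred V 0ℓ
  Fresh Γ = φ (varsᶜ Γ)

  fresh : RawContext → V
  fresh Γ = fr (varsᶜ Γ)

  data IsPrecontext : Pred RawContext 0ℓ where
    empty  : IsPrecontext ⟨⟩
    extend : ∀ {Γ x A} → IsPrecontext Γ → Fresh Γ x → vars A ⊆ₗ varsᶜ Γ →
             IsPrecontext (Γ ▸ x ∶ A)

  TV : RawContext → List V
  TV ⟨⟩          = []
  TV (Γ ▸ x ∶ A) = x ∷ filter (λ y → ¬? (y ∈? vars A)) (TV Γ)

  -- Positions in Γ are counted from the left, x₁ being at position zero; the
  -- reversal undoes the storage order.
  Positions : RawContext → Set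
  Positions Γ = List (Fin (length Γ))

  select : ∀ {A : Set} {n} → Vec A n → List (Fin n) → List A
  select as = map (λ i → Vec.lookup as (opposite i))

  Determining : (Γ : RawContext) → Pred (Positions Γ) 0ℓ
  Determining Γ is = Linked _<_ is × TV Γ ⊆ₗ select (OV Γ) is

  data RawPredeclaration : Set where
    typeDecl : (Γ : RawContext) → T → Positions Γ → RawPredeclaration
    funDecl  : (Γ : RawContext) → F → Positions Γ → Pretype → RawPredeclaration

  IsPredeclaration : Pred RawPredeclaration 0ℓ
  IsPredeclaration (typeDecl Γ S is)  = IsPrecontext Γ × Determining Γ is
  IsPredeclaration (funDecl Γ f is U) =
    IsPrecontext Γ × Determining Γ is × vars U ⊆ₗ varsᶜ Γ

  symbol : RawPredeclaration → F ⊎ T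
  symbol (typeDecl Γ S is)  = inj₂ S
  symbol (funDecl Γ f is U) = inj₁ f

  DeclSet : Set₁
  DeclSet = Pred RawPredeclaration 0ℓ

  Declared : DeclSet → Pred (F ⊎ T) 0ℓ
  Declared Σ s = ∃[ d ] Σ d × symbol d ≡ s

  record IsPresignature (Σ : DeclSet) : Set where
    field
      wellFormed    : ∀ {d} → Σ d → IsPredeclaration d
      declaredOnce  : ∀ {d e} → Σ d → Σ e → symbol d ≡ symbol e → d ≡ e

  data Judgement : Set where
    _context  : RawContext → Judgement
    _type⦅_⦆ : Pretype → RawContext → Judgement
    _∶_⦅_⦆   : Preelement → Pretype → RawContext → Judgement

  -- The judgements aₖ : Aₖ[a₁,…,aₖ₋₁/x₁,…,xₖ₋₁] (Δ), read in the set P.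
  data Components (P : Pred Judgement 0ℓ) (Δ : RawContext) :
                  (Γ : RawContext) → Vec Preelement (length Γ) → Set where
    []  : Components P Δ ⟨⟩ Vec.[]
    _∷_ : ∀ {Γ x A a as} →
          P (a ∶ A [ as / OV Γ ] ⦅ Δ ⦆) → Components P Δ Γ as →
          Components P Δ (Γ ▸ x ∶ A) (a Vec.∷ as)

  record ContextMap (P : Pred Judgement 0ℓ) (Δ Γ : RawContext)
                    (as : Vec Preelement (length Γ)) : Set where
    inductive
    constructor contextMap
    field
      source     : P (Δ context)
      target     : P (Γ context)
      components : Components P Δ Γ as

  -- When Σ consists of predeclarations, the contexts in derivable judgements
  -- are precontexts containing all the variables of the types and elements
  -- judged over them, so admitting raw contexts adds nothing to either set.
  data 𝓙 (Σ : DeclSet) : Pred Judgement 0ℓ where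
    R1 : 𝓙 Σ (⟨⟩ context)
    R2 : ∀ {Γ x A} → 𝓙 Σ (Γ context) → 𝓙 Σ (A type⦅ Γ ⦆) → Fresh Γ x →
         𝓙 Σ (Γ ▸ x ∶ A context)
    R3 : ∀ {Γ x A} → 𝓙 Σ (Γ context) → (x , A) ∈ Γ →
         𝓙 Σ (var x ∶ A ⦅ Γ ⦆)
    R4 : ∀ {Γ S is Δ as} → Σ (typeDecl Γ S is) → ContextMap (𝓙 Σ) Δ Γ as →
         𝓙 Σ (S ⟨ select as is ⟩ type⦅ Δ ⦆)
    R5 : ∀ {Γ f is U Δ as} → Σ (funDecl Γ f is U) → ContextMap (𝓙 Σ) Δ Γ as →
         𝓙 Σ (U [ as / OV Γ ] type⦅ Δ ⦆) →
         𝓙 Σ (f ⟨ select as is ⟩ᶠ ∶ U [ as / OV Γ ] ⦅ Δ ⦆)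

  data 𝓙* (Σ : DeclSet) : Pred Judgement 0ℓ where
    R1  : 𝓙* Σ (⟨⟩ context)
    R2  : ∀ {Γ x A} → 𝓙* Σ (Γ context) → 𝓙* Σ (A type⦅ Γ ⦆) → Fresh Γ x →
          𝓙* Σ (Γ ▸ x ∶ A context)
    R3  : ∀ {Γ x A} → 𝓙* Σ (Γ context) → (x , A) ∈ Γ →
          𝓙* Σ (var x ∶ A ⦅ Γ ⦆)
    R4  : ∀ {Γ S is Δ as} → Σ (typeDecl Γ S is) → ContextMap (𝓙* Σ) Δ Γ as →
          𝓙* Σ (S ⟨ select as is ⟩ type⦅ Δ ⦆)
    R5* : ∀ {Γ f is U Δ as} → Σ (funDecl Γ f is U) → ContextMap (𝓙* Σ) Δ Γ as →
          𝓙* Σ (f ⟨ select as is ⟩ᶠ ∶ U [ as / OV Γ ] ⦅ Δ ⦆)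

  record IsSignature (Σ : DeclSet) : Set where
    field
      isPresignature : IsPresignature Σ
      typeDecl-ok    : ∀ {Γ S is} → Σ (typeDecl Γ S is) → 𝓙 Σ (Γ context)
      funDecl-ok     : ∀ {Γ f is U} → Σ (funDecl Γ f is U) → 𝓙 Σ (U type⦅ Γ ⦆)

  IsFinite : DeclSet → Set
  IsFinite Σ = ∃[ ds ] Σ ≐ (_∈ ds)

  data IsInductive : DeclSet → Set₁ where
    empty   : ∀ {Σ} → Σ ≐ ∅ → IsInductive Σ
    addType : ∀ {Σ Σ′ Γ S is} → IsInductive Σ →
              IsPredeclaration (typeDecl Γ S is) →
              ¬ Declared Σ (inj₂ S) → 𝓙 Σ (Γ context) →
              Σ′ ≐ Σ ∪ ｛ typeDecl Γ S is ｝ → IsInductive Σ′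
    addFun  : ∀ {Σ Σ′ Γ f is U} → IsInductive Σ →
              IsPredeclaration (funDecl Γ f is U) →
              ¬ Declared Σ (inj₁ f) → 𝓙 Σ (U type⦅ Γ ⦆) →
              Σ′ ≐ Σ ∪ ｛ funDecl Γ f is U ｝ → IsInductive Σ′

-- Judgements of 𝓙 are closed under substitution along context maps, by
-- induction on derivations: the premiss "U[b̄/Γ] type" of R5 is itself a
-- derivation and is substituted along with the others, so nothing need be known
-- about how Σ was built up.  In R5*, this premiss is then recovered by
-- substituting ā into "U type (Γ)", which holds in any signature.

{-# OPTIONS --safe #-}
module Submission where

open import Defs
open import Data.Fin.Base using (zero; suc; opposite)
open import Data.List.Base using ([]; _∷_; length)
open import Data.List.Membership.Propositional using (_∈_; _∉_)
open import Data.List.Membership.Propositional.Properties using (∈-map⁺; ∈-++⁺ˡ; ∈-++⁺ʳ; ∈-++⁻)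
open import Data.List.Relation.Binary.Subset.Propositional using () renaming (_⊆_ to _⊆ₗ_)
open import Data.List.Relation.Unary.Any using (here; there)
open import Data.Product.Base using (_,_; proj₁; proj₂)
open import Data.Sum.Base using ([_,_])
open import Data.Vec.Base as Vec using (Vec)
open import Data.Vec.Properties using (lookup-map)
open import Function.Base using (_∘_)
open import Relation.Binary.PropositionalEquality using (_≡_; _≢_; refl; sym; cong; cong₂; subst; subst₂)
open import Relation.Nullary.Decidable using (yes; no)
open import Relation.Nullary.Negation using (contradiction)
open import Relation.Unary using (_≐_)

module _ (L : Language) where
  open Language L
  open Theory L

  here-[/]ᵢ : ∀ {n x a} {as : Vec Preelement n} {xs} →
              x [ a Vec.∷ as / x Vec.∷ xs ]ᵢ ≡ a
  here-[/]ᵢ {x = x} with x ≟V x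
  ... | yes _  = refl
  ... | no x≢x = contradiction refl x≢x

  there-[/]ᵢ : ∀ {n x y a} {as : Vec Preelement n} {xs} → y ≢ x →
               y [ a Vec.∷ as / x Vec.∷ xs ]ᵢ ≡ y [ as / xs ]ᵢ
  there-[/]ᵢ {x = x} {y} y≢x with y ≟V x
  ... | yes y≡x = contradiction y≡x y≢x
  ... | no _    = refl

  module _ {n} {x : V} {a : Preelement} {as : Vec Preelement n} {xs : Vec V n} where

    mutual
      drop-[/]ₑ : ∀ t → x ∉ varsₑ t → t [ a Vec.∷ as / x Vec.∷ xs ]ₑ ≡ t [ as / xs ]ₑ
      drop-[/]ₑ (var y)     x∉ = there-[/]ᵢ {as = as} {xs} (x∉ ∘ here ∘ sym)
      drop-[/]ₑ (f ⟨ ts ⟩ᶠ) x∉ = cong (f ⟨_⟩ᶠ) (drop-[/]ₑₛ ts x∉)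

      drop-[/]ₑₛ : ∀ ts → x ∉ varsₑₛ ts → ts [ a Vec.∷ as / x Vec.∷ xs ]ₑₛ ≡ ts [ as / xs ]ₑₛ
      drop-[/]ₑₛ []       x∉ = refl
      drop-[/]ₑₛ (t ∷ ts) x∉ =
        cong₂ _∷_ (drop-[/]ₑ t (x∉ ∘ ∈-++⁺ˡ)) (drop-[/]ₑₛ ts (x∉ ∘ ∈-++⁺ʳ (varsₑ t)))

    -- Meant for the newest variable `x` of a context: freshness keeps it out of the types of all
    -- earlier entries, so these types may be read under the full substitution or under the
    -- truncated one.
    drop-[/] : ∀ A → x ∉ vars A → A [ a Vec.∷ as / x Vec.∷ xs ] ≡ A [ as / xs ]
    drop-[/] (S ⟨ ts ⟩) x∉ = cong (S ⟨_⟩) (drop-[/]ₑₛ ts x∉)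

  module _ {m} (as : Vec Preelement m) (xs : Vec V m) where

    infixl 8 _[σ]
    _[σ] : ∀ {n} → Vec Preelement n → Vec Preelement n
    bs [σ] = Vec.map (_[ as / xs ]ₑ) bs

    select-[/] : ∀ {n} (bs : Vec Preelement n) is →
                 select bs is [ as / xs ]ₑₛ ≡ select (bs [σ]) is
    select-[/] bs []       = refl
    select-[/] bs (i ∷ is) =
      cong₂ _∷_ (sym (lookup-map (opposite i) (_[ as / xs ]ₑ) bs)) (select-[/] bs is)

    -- Scoping matters here: a `y` outside `varsᶜ Γ` passes through the inner substitution as a
    -- variable and may then be replaced by `as`, while the right-hand side leaves it alone. The
    -- inclusions assumed in the composition laws below all serve this case.
    [/]ᵢ-[/] : ∀ Γ (bs : Vec Preelement (length Γ)) {y} → y ∈ varsᶜ Γ →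
               y [ bs / OV Γ ]ᵢ [ as / xs ]ₑ ≡ y [ bs [σ] / OV Γ ]ᵢ
    [/]ᵢ-[/] (Γ ▸ x ∶ A) (b Vec.∷ bs) {y} y∈ with y ≟V x
    [/]ᵢ-[/] (Γ ▸ x ∶ A) (b Vec.∷ bs) y∈         | yes _  = refl
    [/]ᵢ-[/] (Γ ▸ x ∶ A) (b Vec.∷ bs) (here y≡x) | no y≢x = contradiction y≡x y≢x
    [/]ᵢ-[/] (Γ ▸ x ∶ A) (b Vec.∷ bs) (there y∈) | no _   = [/]ᵢ-[/] Γ bs y∈

    module _ (Γ : RawContext) (bs : Vec Preelement (length Γ)) where

      mutual
        [/]ₑ-[/] : ∀ t → varsₑ t ⊆ₗ varsᶜ Γ →
                   t [ bs / OV Γ ]ₑ [ as / xs ]ₑ ≡ t [ bs [σ] / OV Γ ]ₑ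
        [/]ₑ-[/] (var y)     t⊆ = [/]ᵢ-[/] Γ bs (t⊆ (here refl))
        [/]ₑ-[/] (f ⟨ ts ⟩ᶠ) t⊆ = cong (f ⟨_⟩ᶠ) ([/]ₑₛ-[/] ts t⊆)

        [/]ₑₛ-[/] : ∀ ts → varsₑₛ ts ⊆ₗ varsᶜ Γ →
                    ts [ bs / OV Γ ]ₑₛ [ as / xs ]ₑₛ ≡ ts [ bs [σ] / OV Γ ]ₑₛ
        [/]ₑₛ-[/] []       ts⊆ = refl
        [/]ₑₛ-[/] (t ∷ ts) ts⊆ =
          cong₂ _∷_ ([/]ₑ-[/] t (ts⊆ ∘ ∈-++⁺ˡ)) ([/]ₑₛ-[/] ts (ts⊆ ∘ ∈-++⁺ʳ (varsₑ t)))

      [/]-[/] : ∀ A → vars A ⊆ₗ varsᶜ Γ →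
                A [ bs / OV Γ ] [ as / xs ] ≡ A [ bs [σ] / OV Γ ]
      [/]-[/] (S ⟨ ts ⟩) A⊆ = cong (S ⟨_⟩) ([/]ₑₛ-[/] ts A⊆)

  varsₑₛ-select : ∀ {n X} (as : Vec Preelement n) →
                  (∀ i → varsₑ (Vec.lookup as i) ⊆ₗ X) → ∀ is → varsₑₛ (select as is) ⊆ₗ X
  varsₑₛ-select as as⊆ (i ∷ is) y∈ =
    [ as⊆ (opposite i) , varsₑₛ-select as as⊆ is ] (∈-++⁻ (varsₑ (Vec.lookup as (opposite i))) y∈)

  entry-vars : ∀ {Γ x A} → IsPrecontext Γ → (x , A) ∈ Γ → vars A ⊆ₗ varsᶜ Γ
  entry-vars (extend pΓ _ A⊆) (here refl) = there ∘ A⊆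
  entry-vars (extend pΓ _ _)  (there x∈)  = there ∘ entry-vars pΓ x∈

  -- This is the variable case of substitution. `Components` types each term under the substitution
  -- of the preceding terms only, while R3 calls for the substitution of the whole sequence;
  -- `drop-[/]` closes the gap one entry at a time.
  Components-lookup : ∀ {P Δ Γ as x A} → IsPrecontext Γ → Components P Δ Γ as →
                      (x , A) ∈ Γ → P (x [ as / OV Γ ]ᵢ ∶ A [ as / OV Γ ] ⦅ Δ ⦆)
  Components-lookup {P} {Δ} {Γ ▸ x ∶ A} {a Vec.∷ as} (extend _ fx A⊆) (p ∷ _) (here refl) =
    subst₂ (λ t B → P (t ∶ B ⦅ Δ ⦆))
      (sym (here-[/]ᵢ {x = x} {as = as} {OV Γ})) (sym (drop-[/] A (φ-fresh fx ∘ A⊆))) p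
  Components-lookup {P} {Δ} {Γ ▸ y ∶ _} {_ Vec.∷ as} {x} {A} (extend pΓ fy _) (_ ∷ ps) (there x∈) =
    subst₂ (λ t B → P (t ∶ B ⦅ Δ ⦆))
      -- If `x` were `y`, then `y` would occur in `Γ`, for which it is fresh.
      (sym (there-[/]ᵢ {as = as} {OV Γ} λ { refl → φ-fresh fy (∈-map⁺ proj₁ x∈) }))
      (sym (drop-[/] A (φ-fresh fy ∘ entry-vars pΓ x∈)))
      (Components-lookup pΓ ps x∈)

  module _ {Σ : DeclSet} where

    mutual
      -- Recovers from derivations the freshness and scoping that raw contexts do not carry and that
      -- the substitution lemmas require. R4 and R5 apply a symbol to selected components of a
      -- context map, so variables are traced back through the components to R3, where they are
      -- entries of the context.
      context⇒precontext : ∀ {Γ} → 𝓙 Σ (Γ context) → IsPrecontext Γ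
      context⇒precontext R1           = empty
      context⇒precontext (R2 dΓ dA fx) = extend (context⇒precontext dΓ) fx (type-vars dA)

      type-vars : ∀ {A Γ} → 𝓙 Σ (A type⦅ Γ ⦆) → vars A ⊆ₗ varsᶜ Γ
      type-vars (R4 {is = is} {as = as} _ (contextMap _ _ cs)) =
        varsₑₛ-select as (Components-vars cs) is

      element-vars : ∀ {a A Γ} → 𝓙 Σ (a ∶ A ⦅ Γ ⦆) → varsₑ a ⊆ₗ varsᶜ Γ
      element-vars (R3 _ x∈) (here refl) = ∈-map⁺ proj₁ x∈
      element-vars (R5 {is = is} {as = as} _ (contextMap _ _ cs) _) =
        varsₑₛ-select as (Components-vars cs) is

      Components-vars : ∀ {Δ Γ as} → Components (𝓙 Σ) Δ Γ as →
                        ∀ i → varsₑ (Vec.lookup as i) ⊆ₗ varsᶜ Δ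
      Components-vars (d ∷ _)  zero    = element-vars d
      Components-vars (_ ∷ ds) (suc i) = Components-vars ds i

  module _ {Σ : DeclSet} (sig : IsSignature Σ) where
    open IsSignature sig
    open IsPresignature isPresignature

    module _ {Δ Γ as} (dΔ : 𝓙 Σ (Δ context)) (cs : Components (𝓙 Σ) Δ Γ as) where

      mutual
        -- In a context map used by R4 or R5, the source `Γ` is replaced by `Δ` and the components
        -- are composed with `as`; the target keeps its own derivation.
        type-[/] : ∀ {A} → 𝓙 Σ (A type⦅ Γ ⦆) → 𝓙 Σ (A [ as / OV Γ ] type⦅ Δ ⦆)
        type-[/] (R4 {S = S} {is} {as = bs} S∈ (contextMap _ dΘ ds)) =
          subst (λ ts → 𝓙 Σ (S ⟨ ts ⟩ type⦅ Δ ⦆)) (sym (select-[/] as (OV Γ) bs is))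
            (R4 S∈ (contextMap dΔ dΘ (Components-[/] (context⇒precontext dΘ) ds)))

        element-[/] : ∀ {a A} → 𝓙 Σ (a ∶ A ⦅ Γ ⦆) →
                      𝓙 Σ (a [ as / OV Γ ]ₑ ∶ A [ as / OV Γ ] ⦅ Δ ⦆)
        element-[/] (R3 dΓ x∈) = Components-lookup (context⇒precontext dΓ) cs x∈
        element-[/] (R5 {Θ} {f} {is} {U} {as = bs} f∈ (contextMap _ dΘ ds) dU) =
          subst₂ (λ ts B → 𝓙 Σ (f ⟨ ts ⟩ᶠ ∶ B ⦅ Δ ⦆))
            (sym (select-[/] as (OV Γ) bs is)) (sym U-eq)
            (R5 f∈ (contextMap dΔ dΘ (Components-[/] (context⇒precontext dΘ) ds))
              (subst (λ B → 𝓙 Σ (B type⦅ Δ ⦆)) U-eq (type-[/] dU)))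
          where
          -- Well-formedness of the declaration puts the variables of `U` in `Θ`. The equation is
          -- used forwards on the substituted type premiss and backwards on the conclusion.
          U-eq = [/]-[/] as (OV Γ) Θ bs U (proj₂ (proj₂ (wellFormed f∈)))

        -- The recursion also runs along `IsPrecontext Θ`, which supplies at each entry the
        -- inclusion needed to merge the two substitutions in its type.
        Components-[/] : ∀ {Θ bs} → IsPrecontext Θ → Components (𝓙 Σ) Γ Θ bs →
                         Components (𝓙 Σ) Δ Θ (_[σ] as (OV Γ) bs)
        Components-[/] empty [] = []
        Components-[/] (extend {Θ} {A = A} pΘ _ A⊆) (_∷_ {as = bs} d ds) =
          subst (λ B → 𝓙 Σ (_ ∶ B ⦅ Δ ⦆)) ([/]-[/] as (OV Γ) Θ bs A A⊆) (element-[/] d)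
            ∷ Components-[/] pΘ ds

    mutual
      𝓙*⇒𝓙 : ∀ {J} → 𝓙* Σ J → 𝓙 Σ J
      𝓙*⇒𝓙 R1            = R1
      𝓙*⇒𝓙 (R2 dΓ dA fx) = R2 (𝓙*⇒𝓙 dΓ) (𝓙*⇒𝓙 dA) fx
      𝓙*⇒𝓙 (R3 dΓ x∈)    = R3 (𝓙*⇒𝓙 dΓ) x∈
      𝓙*⇒𝓙 (R4 S∈ (contextMap dΔ dΓ cs)) =
        R4 S∈ (contextMap (𝓙*⇒𝓙 dΔ) (𝓙*⇒𝓙 dΓ) (Components-𝓙*⇒𝓙 cs))
      𝓙*⇒𝓙 (R5* f∈ (contextMap dΔ dΓ cs)) =
        R5 f∈ (contextMap (𝓙*⇒𝓙 dΔ) (𝓙*⇒𝓙 dΓ) (Components-𝓙*⇒𝓙 cs))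
          -- `funDecl-ok f∈` already lies in `𝓙`, so the recursive calls concern only the premisses
          -- of R5*.
          (type-[/] (𝓙*⇒𝓙 dΔ) (Components-𝓙*⇒𝓙 cs) (funDecl-ok f∈))

      Components-𝓙*⇒𝓙 : ∀ {Δ Γ as} → Components (𝓙* Σ) Δ Γ as → Components (𝓙 Σ) Δ Γ as
      Components-𝓙*⇒𝓙 []       = []
      Components-𝓙*⇒𝓙 (d ∷ ds) = 𝓙*⇒𝓙 d ∷ Components-𝓙*⇒𝓙 ds

  module _ {Σ : DeclSet} where

    mutual
      𝓙⇒𝓙* : ∀ {J} → 𝓙 Σ J → 𝓙* Σ J
      𝓙⇒𝓙* R1            = R1
      𝓙⇒𝓙* (R2 dΓ dA fx) = R2 (𝓙⇒𝓙* dΓ) (𝓙⇒𝓙* dA) fx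
      𝓙⇒𝓙* (R3 dΓ x∈)    = R3 (𝓙⇒𝓙* dΓ) x∈
      𝓙⇒𝓙* (R4 S∈ (contextMap dΔ dΓ cs)) =
        R4 S∈ (contextMap (𝓙⇒𝓙* dΔ) (𝓙⇒𝓙* dΓ) (Components-𝓙⇒𝓙* cs))
      𝓙⇒𝓙* (R5 f∈ (contextMap dΔ dΓ cs) _) =
        R5* f∈ (contextMap (𝓙⇒𝓙* dΔ) (𝓙⇒𝓙* dΓ) (Components-𝓙⇒𝓙* cs))

      Components-𝓙⇒𝓙* : ∀ {Δ Γ as} → Components (𝓙 Σ) Δ Γ as → Components (𝓙* Σ) Δ Γ as
      Components-𝓙⇒𝓙* []       = []
      Components-𝓙⇒𝓙* (d ∷ ds) = 𝓙⇒𝓙* d ∷ Components-𝓙⇒𝓙* ds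

mainTheorem7 : (L : Language) → let open Theory L in
    (Σ : DeclSet) → IsSignature Σ → IsFinite Σ → IsInductive Σ → 𝓙 Σ ≐ 𝓙* Σ
mainTheorem7 L Σ sig _ _ = 𝓙⇒𝓙* L , 𝓙*⇒𝓙 L sig
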